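{- Let $(t_j^i)_{0\le j\le i}$ be real numbers and let $h_{j,k}^i$ ($0\le k\le i$, $0\le j\le i-k$) be defined by $h_{j,0}^i=t_j^i$ and $h_{j,k}^i=h_{j,k-1}^{i-1}+h_{j,k-1}^{i}+h_{j+1,k-1}^{i}$ for $k\ge 1$. If $t_j^i=t_{i-j}^i$ for all $0\le j\le i$, then $h_{j,k}^i=h_{i-(j+k),k}^i$ for all $0\leq k \leq i$, $0\leq j \leq i-k$. -}

module Defs where

open import Data.Nat using (ℕ; zero; suc; _∸_; _≤_; _⊔_; s≤s; s≤s⁻¹)
import Data.Nat.Properties as ℕ
open import Data.Product using (∃-syntax; _,_)
open import Data.Rational as ℚ using (ℚ; 0ℚ; ½; ∣_∣; positive)
import Data.Rational.Properties as ℚ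
open import Data.Rational.Solver using (module +-*-Solver)
open import Relation.Binary.PropositionalEquality using (_≡_; refl; sym; trans; subst)

-- Real numbers are Cauchy sequences of rationals, with equality _≈_ saying that
-- the difference of the two sequences tends to 0.

IsCauchy : (ℕ → ℚ) → Set
IsCauchy x = ∀ ε → 0ℚ ℚ.< ε →
  ∃[ N ] (∀ m n → N ≤ m → N ≤ n → ∣ x m ℚ.- x n ∣ ℚ.< ε)

record ℝ : Set where
  constructor mkℝ
  no-eta-equality
  field
    seq    : ℕ → ℚ
    cauchy : IsCauchy seq

open ℝ public

infix 4 _≈_

-- A record, so that x and y can be inferred from a proof of x ≈ y.
record _≈_ (x y : ℝ) : Set where
  constructor mk≈
  field
    close : ∀ ε → 0ℚ ℚ.< ε → ∃[ N ] (∀ n → N ≤ n → ∣ seq x n ℚ.- seq y n ∣ ℚ.< ε)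

open _≈_ public

½*-pos : ∀ {ε} → 0ℚ ℚ.< ε → 0ℚ ℚ.< ½ ℚ.* ε
½*-pos {ε} 0<ε = ℚ.positive⁻¹ (½ ℚ.* ε) {{ℚ.pos*pos⇒pos ½ ε {{positive 0<ε}}}}

½*+½* : ∀ ε → ½ ℚ.* ε ℚ.+ ½ ℚ.* ε ≡ ε
½*+½* ε = trans (sym (ℚ.*-distribʳ-+ ε ½ ½)) (ℚ.*-identityˡ ε)

∣+∣<ε : ∀ {ε} p q → ∣ p ∣ ℚ.< ½ ℚ.* ε → ∣ q ∣ ℚ.< ½ ℚ.* ε → ∣ p ℚ.+ q ∣ ℚ.< ε
∣+∣<ε {ε} p q p< q< =
  ℚ.≤-<-trans (ℚ.∣p+q∣≤∣p∣+∣q∣ p q) (subst (_ ℚ.<_) (½*+½* ε) (ℚ.+-mono-< p< q<))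

[p-q]+[r-s]≡[p+r]-[q+s] : ∀ p q r s →
  (p ℚ.- q) ℚ.+ (r ℚ.- s) ≡ (p ℚ.+ r) ℚ.- (q ℚ.+ s)
[p-q]+[r-s]≡[p+r]-[q+s] =
  solve 4 (λ p q r s → (p :- q) :+ (r :- s) := (p :+ r) :- (q :+ s)) refl
  where open +-*-Solver

+-cauchy : ∀ x y → IsCauchy x → IsCauchy y → IsCauchy (λ n → x n ℚ.+ y n)
+-cauchy x y cx cy ε 0<ε with cx (½ ℚ.* ε) (½*-pos 0<ε) | cy (½ ℚ.* ε) (½*-pos 0<ε)
... | M , x< | N , y< = M ⊔ N , λ m n ≤m ≤n →
  subst (λ d → ∣ d ∣ ℚ.< ε) ([p-q]+[r-s]≡[p+r]-[q+s] (x m) (x n) (y m) (y n))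
    (∣+∣<ε (x m ℚ.- x n) (y m ℚ.- y n)
      (x< m n (ℕ.m⊔n≤o⇒m≤o M N ≤m) (ℕ.m⊔n≤o⇒m≤o M N ≤n))
      (y< m n (ℕ.m⊔n≤o⇒n≤o M N ≤m) (ℕ.m⊔n≤o⇒n≤o M N ≤n)))

infixl 6 _+_

_+_ : ℝ → ℝ → ℝ
seq    (x + y) n = seq x n ℚ.+ seq y n
cauchy (x + y)   = +-cauchy (seq x) (seq y) (cauchy x) (cauchy y)

-- t i j _ is t_j^i.
Triangle : Set
Triangle = (i j : ℕ) → .(j ≤ i) → ℝ

j≤i∸k⇒1+j≤1+i∸k : ∀ {i j k} → k ≤ i → j ≤ i ∸ k → suc j ≤ suc i ∸ k
j≤i∸k⇒1+j≤1+i∸k {j = j} k≤i j≤ = subst (suc j ≤_) (sym (ℕ.+-∸-assoc 1 k≤i)) (s≤s j≤)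

-- h t i j k _ _ is h_{j,k}^i.
h : Triangle → (i j k : ℕ) → .(k ≤ i) → .(j ≤ i ∸ k) → ℝ
h t i       j zero    _   j≤ = t i j j≤
h t (suc i) j (suc k) k≤i j≤ =
    h t i       j       k (s≤s⁻¹ k≤i) j≤
  + h t (suc i) j       k (ℕ.m≤n⇒m≤1+n (s≤s⁻¹ k≤i)) (ℕ.<⇒≤ (j≤i∸k⇒1+j≤1+i∸k (s≤s⁻¹ k≤i) j≤))
  + h t (suc i) (suc j) k (ℕ.m≤n⇒m≤1+n (s≤s⁻¹ k≤i)) (j≤i∸k⇒1+j≤1+i∸k (s≤s⁻¹ k≤i) j≤)

{-# OPTIONS --safe #-}
-- Reflecting j ↦ i - (j + k) fixes the first summand of the recurrence and exchanges
-- the other two, so the symmetry passes from k to k + 1. Two indices j and j′ are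
-- reflections of each other exactly when j + j′ + k = i, which avoids subtraction.
module Submission where

open import Data.Nat using (ℕ; zero; suc; _∸_; _≤_; _⊔_) renaming (_+_ to _+ℕ_)
open import Data.Nat.Properties using (m∸n≤m; ∸-monoʳ-≤; m≤n+m; m≤m+n; m+n∸m≡n; +-identityʳ; +-suc; +-assoc; +-comm; m+[n∸m]≡n; m∸n+n≡m; +-monoˡ-≤; suc-injective; m⊔n≤o⇒m≤o; m⊔n≤o⇒n≤o)
open import Data.Product using (_,_)
open import Data.Rational as ℚ using (∣_∣; ½)
open import Data.Rational.Solver using (module +-*-Solver)
open import Relation.Binary.PropositionalEquality using (_≡_; refl; sym; trans; cong; subst)
open import Defs

-- Lets summands be reordered by an identity in `ℚ` at each index, with no limit argument.
≈-respʳ-seq : ∀ {x y z} → (∀ n → seq y n ≡ seq z n) → x ≈ y → x ≈ z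
≈-respʳ-seq {x} y≗z x≈y = mk≈ λ ε 0<ε → let N , x-y< = close x≈y ε 0<ε in
  N , λ n N≤n → subst (λ q → ∣ seq x n ℚ.- q ∣ ℚ.< ε) (y≗z n) (x-y< n N≤n)

+-cong : ∀ {x x′ y y′} → x ≈ x′ → y ≈ y′ → x + y ≈ x′ + y′
+-cong {x} {x′} {y} {y′} x≈x′ y≈y′ = mk≈ λ ε 0<ε →
  let M , x< = close x≈x′ (½ ℚ.* ε) (½*-pos 0<ε)
      N , y< = close y≈y′ (½ ℚ.* ε) (½*-pos 0<ε)
  in M ⊔ N , λ n ≤n →
    subst (λ d → ∣ d ∣ ℚ.< ε)
      ([p-q]+[r-s]≡[p+r]-[q+s] (seq x n) (seq x′ n) (seq y n) (seq y′ n))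
      (∣+∣<ε (seq x n ℚ.- seq x′ n) (seq y n ℚ.- seq y′ n)
        (x< n (m⊔n≤o⇒m≤o M N ≤n)) (y< n (m⊔n≤o⇒n≤o M N ≤n)))

-- The crossed hypotheses fit the recurrence of `h`, whose last two summands trade places.
+-cong-swap : ∀ {x x′ y y′ z z′} → x ≈ x′ → y ≈ z′ → z ≈ y′ → x + y + z ≈ x′ + y′ + z′
+-cong-swap {x′ = x′} {y′ = y′} {z′ = z′} x≈x′ y≈z′ z≈y′ =
  ≈-respʳ-seq (λ n → swap (seq x′ n) (seq z′ n) (seq y′ n))
    (+-cong (+-cong x≈x′ y≈z′) z≈y′)
  where
  open +-*-Solver
  swap : ∀ p q r → p ℚ.+ q ℚ.+ r ≡ p ℚ.+ r ℚ.+ q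
  swap = solve 3 (λ p q r → p :+ q :+ r := p :+ r :+ q) refl

module _ (t : Triangle)
  (t-sym : (i j : ℕ) (j≤i : j ≤ i) → t i j j≤i ≈ t i (i ∸ j) (m∸n≤m i j)) where

  t-reflect : ∀ i j j′ → j +ℕ j′ ≡ i → .(j≤ : j ≤ i) .(j′≤ : j′ ≤ i) →
    t i j j≤ ≈ t i j′ j′≤
  t-reflect _ j j′ refl _ _ = at (m+n∸m≡n j j′)
    where
    -- `j′` also occurs in the row `j +ℕ j′`, so the target index becomes a fresh variable `l`
    -- before the equation is matched with `refl`.
    at : ∀ {l} → j +ℕ j′ ∸ j ≡ l → .{l≤ : l ≤ j +ℕ j′} →
      t (j +ℕ j′) j (m≤m+n j j′) ≈ t (j +ℕ j′) l l≤
    at refl = t-sym (j +ℕ j′) j (m≤m+n j j′)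

  -- Induction on `k` with row and columns left general, since the recurrence changes both.
  h-reflect : ∀ i j j′ k → j +ℕ j′ +ℕ k ≡ i →
    .(k≤i : k ≤ i) .(j≤ : j ≤ i ∸ k) .(j′≤ : j′ ≤ i ∸ k) →
    h t i j k k≤i j≤ ≈ h t i j′ k k≤i j′≤
  h-reflect i j j′ zero eq _ j≤ j′≤ =
    t-reflect i j j′ (trans (sym (+-identityʳ _)) eq) j≤ j′≤
  h-reflect zero j j′ (suc k) eq ()
  h-reflect (suc i) j j′ (suc k) eq _ _ _ =
    +-cong-swap
      (h-reflect i j j′ k (suc-injective 1+sum≡1+i) _ _ _)
      -- In row `suc i`, lowering `suc k` to `k` leaves one unit to restore in the sum: given to
      -- `j′` it sends the second summand to the third, given to `j` the third to the second.
      (h-reflect (suc i) j (suc j′) k (trans (cong (_+ℕ k) (+-suc j j′)) 1+sum≡1+i) _ _ _)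
      (h-reflect (suc i) (suc j) j′ k 1+sum≡1+i _ _ _)
    where
    1+sum≡1+i : suc (j +ℕ j′ +ℕ k) ≡ suc i
    1+sum≡1+i = trans (sym (+-suc (j +ℕ j′) k)) eq

-- The bounds give `j +ℕ k ≤ i`, so the truncated subtraction is exact.
j+[i∸[j+k]]+k≡i : ∀ {i j k} → k ≤ i → j ≤ i ∸ k → j +ℕ (i ∸ (j +ℕ k)) +ℕ k ≡ i
j+[i∸[j+k]]+k≡i {i} {j} {k} k≤i j≤ =
  trans (+-assoc j l k) (trans (cong (j +ℕ_) (+-comm l k))
    (trans (sym (+-assoc j k l)) (m+[n∸m]≡n j+k≤i)))
  where
  l = i ∸ (j +ℕ k)
  j+k≤i : j +ℕ k ≤ i
  j+k≤i = subst (j +ℕ k ≤_) (m∸n+n≡m k≤i) (+-monoˡ-≤ k j≤)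

theorem5 : (t : Triangle) →
    ((i j : ℕ) (j≤i : j ≤ i) → t i j j≤i ≈ t i (i ∸ j) (m∸n≤m i j)) →
    (i j k : ℕ) (k≤i : k ≤ i) (j≤i∸k : j ≤ i ∸ k) →
    h t i j k k≤i j≤i∸k ≈ h t i (i ∸ (j +ℕ k)) k k≤i (∸-monoʳ-≤ i (m≤n+m k j))
theorem5 t t-sym i j k k≤i j≤i∸k =
  h-reflect t t-sym i j (i ∸ (j +ℕ k)) k (j+[i∸[j+k]]+k≡i k≤i j≤i∸k) k≤i j≤i∸k
    (∸-monoʳ-≤ i (m≤n+m k j))
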